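{- Let $s\ge 2$ and $n\ge 2$ be integers, and let \[f(x)=(x^{s}-1)^{n}-x^{n-1}(x^{s-1}-1)^{n},\qquad g(x)=x^{ns}-x^{ns-1}+x^{n-1}-1.\] If $\alpha\in\mathbb{C}$ is a root of $g(x)$, then $\alpha^{n}$ is a root of $f(x)$.
   Context: Here (after the substitution $x=1-q$) $f$ is, up to the factor $(x-1)^n$, the interesting factor of the chromatic polynomial of the theta-graph with $n$ paths of length $s$, and $g$ is the interesting factor of the chromatic polynomial of the generalised theta graph with paths of lengths $ns-n+1,\ldots,ns$. -}

module Defs where

open import Algebra.Bundles using (CommutativeRing)
import Algebra.Properties.Semiring.Exp as Exp
open import Data.Nat.Base as ℕ using (ℕ; _⊔_; _∸_)
import Data.Nat.Properties as ℕ
open import Data.Product.Base using (_×_; _,_; ∃-syntax)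
open import Data.Rational.Base using (ℚ; 0ℚ; 1ℚ; ½; _+_; _*_; _-_; -_; _<_; _≤_; ∣_∣; 1/_; Positive; NonZero; positive; nonNegative)
import Data.Rational.Properties as ℚ
open import Data.Rational.Solver using (module +-*-Solver)
open import Level using (0ℓ)
open import Relation.Binary.PropositionalEquality using (_≡_; refl; sym; trans; cong; subst)

open +-*-Solver using (solve; _:=_; con; _:+_; _:*_; _:-_; :-_)

-- Real numbers: Cauchy sequences of rationals, with x ≈ y iff x - y tends to 0.

IsCauchy : (ℕ → ℚ) → Set
IsCauchy x = ∀ ε → 0ℚ < ε → ∃[ N ] ∀ m n → N ℕ.≤ m → N ℕ.≤ n → ∣ x m - x n ∣ < ε

IsNull : (ℕ → ℚ) → Set
IsNull x = ∀ ε → 0ℚ < ε → ∃[ N ] ∀ m → N ℕ.≤ m → ∣ x m ∣ < ε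

record ℝ : Set where
  no-eta-equality
  field
    seq    : ℕ → ℚ
    cauchy : IsCauchy seq

open ℝ

infix 4 _≈ᴿ_

-- A record, so that the two reals can be inferred from a proof.
record _≈ᴿ_ (x y : ℝ) : Set where
  constructor mk≈
  field
    difference-null : IsNull (λ k → seq x k - seq y k)

open _≈ᴿ_

private
  -- Double sequences treat IsCauchy and IsNull uniformly:
  -- IsCauchy x is IsNull₂ (λ m n → x m - x n).
  IsNull₂ : (ℕ → ℕ → ℚ) → Set
  IsNull₂ d = ∀ ε → 0ℚ < ε → ∃[ N ] ∀ m n → N ℕ.≤ m → N ℕ.≤ n → ∣ d m n ∣ < ε

  IsBounded₂ : (ℕ → ℕ → ℚ) → Set
  IsBounded₂ b = ∃[ B ] (0ℚ < B) × (∃[ N ] ∀ m n → N ℕ.≤ m → N ℕ.≤ n → ∣ b m n ∣ ≤ B)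

private abstract
  null⇒null₂ : ∀ {x} → IsNull x → IsNull₂ (λ m _ → x m)
  null⇒null₂ h ε ε>0 with N , p ← h ε ε>0 = N , λ m _ N≤m _ → p m N≤m

  null₂⇒null : ∀ {x} → IsNull₂ (λ m _ → x m) → IsNull x
  null₂⇒null h ε ε>0 with N , p ← h ε ε>0 = N , λ m N≤m → p m m N≤m N≤m

  null₂-resp : ∀ {d e} → (∀ m n → d m n ≡ e m n) → IsNull₂ d → IsNull₂ e
  null₂-resp d≡e h ε ε>0 with N , p ← h ε ε>0 =
    N , λ m n N≤m N≤n → subst (λ q → ∣ q ∣ < ε) (d≡e m n) (p m n N≤m N≤n)

  null₂-zero : IsNull₂ (λ _ _ → 0ℚ)
  null₂-zero ε ε>0 = 0 , λ _ _ _ _ → ε>0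

  null₂-neg : ∀ {d} → IsNull₂ d → IsNull₂ (λ m n → - d m n)
  null₂-neg {d} h ε ε>0 with N , p ← h ε ε>0 =
    N , λ m n N≤m N≤n → subst (_< ε) (sym (ℚ.∣-p∣≡∣p∣ (d m n))) (p m n N≤m N≤n)

  half-pos : ∀ {ε} → 0ℚ < ε → 0ℚ < ½ * ε
  half-pos {ε} ε>0 = ℚ.positive⁻¹ (½ * ε) {{ℚ.pos*pos⇒pos ½ ε {{positive ε>0}}}}

  half+half : ∀ ε → ½ * ε + ½ * ε ≡ ε
  half+half ε = trans (sym (ℚ.*-distribʳ-+ ε ½ ½)) (ℚ.*-identityˡ ε)

  null₂-+ : ∀ {d e} → IsNull₂ d → IsNull₂ e → IsNull₂ (λ m n → d m n + e m n)
  null₂-+ {d} {e} h k ε ε>0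
    with M , p ← h (½ * ε) (half-pos ε>0) | N , q ← k (½ * ε) (half-pos ε>0) =
    M ⊔ N , λ m n ≤m ≤n → subst (∣ d m n + e m n ∣ <_) (half+half ε)
      (ℚ.≤-<-trans (ℚ.∣p+q∣≤∣p∣+∣q∣ (d m n) (e m n))
        (ℚ.+-mono-<
          (p m n (ℕ.m⊔n≤o⇒m≤o M N ≤m) (ℕ.m⊔n≤o⇒m≤o M N ≤n))
          (q m n (ℕ.m⊔n≤o⇒n≤o M N ≤m) (ℕ.m⊔n≤o⇒n≤o M N ≤n))))

  null₂-* : ∀ {b d} → IsBounded₂ b → IsNull₂ d → IsNull₂ (λ m n → b m n * d m n)
  null₂-* {b} {d} (B , B>0 , M , p) h ε ε>0 = result (h δ δ>0)
    where
    instance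
      B-pos : Positive B
      B-pos = positive B>0
      B-nonZero : NonZero B
      B-nonZero = ℚ.pos⇒nonZero B
    δ : ℚ
    δ = 1/ B * ε
    δ>0 : 0ℚ < δ
    δ>0 = ℚ.positive⁻¹ δ {{ℚ.pos*pos⇒pos (1/ B) {{ℚ.1/pos⇒pos B}} ε {{positive ε>0}}}}
    Bδ≡ε : B * δ ≡ ε
    Bδ≡ε = trans (sym (ℚ.*-assoc B (1/ B) ε))
      (trans (cong (_* ε) (ℚ.*-inverseʳ B)) (ℚ.*-identityˡ ε))
    result : ∃[ N ] (∀ m n → N ℕ.≤ m → N ℕ.≤ n → ∣ d m n ∣ < δ) →
             ∃[ N ] (∀ m n → N ℕ.≤ m → N ℕ.≤ n → ∣ b m n * d m n ∣ < ε)
    result (N , q) = M ⊔ N , λ m n ≤m ≤n →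
      subst (_< ε) (sym (ℚ.∣p*q∣≡∣p∣*∣q∣ (b m n) (d m n)))
        (subst (∣ b m n ∣ * ∣ d m n ∣ <_) Bδ≡ε
          (ℚ.≤-<-trans
            (ℚ.*-monoʳ-≤-nonNeg ∣ d m n ∣ {{nonNegative (ℚ.0≤∣p∣ (d m n))}}
              (p m n (ℕ.m⊔n≤o⇒m≤o M N ≤m) (ℕ.m⊔n≤o⇒m≤o M N ≤n)))
            (ℚ.*-monoʳ-<-pos B
              (q m n (ℕ.m⊔n≤o⇒n≤o M N ≤m) (ℕ.m⊔n≤o⇒n≤o M N ≤n)))))

  cauchy⇒bounded : ∀ x → IsCauchy x → ∃[ B ] (0ℚ < B) × (∃[ N ] ∀ m → N ℕ.≤ m → ∣ x m ∣ ≤ B)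
  cauchy⇒bounded x c with N , p ← c 1ℚ (ℚ.positive⁻¹ 1ℚ) =
    1ℚ + ∣ x N ∣ , ℚ.+-mono-<-≤ (ℚ.positive⁻¹ 1ℚ) (ℚ.0≤∣p∣ (x N)) , N , λ m N≤m →
      subst (λ q → ∣ q ∣ ≤ 1ℚ + ∣ x N ∣)
        (solve 2 (λ a b → (a :- b) :+ b := a) refl (x m) (x N))
        (ℚ.≤-trans (ℚ.∣p+q∣≤∣p∣+∣q∣ (x m - x N) (x N))
          (ℚ.+-monoˡ-≤ ∣ x N ∣ (ℚ.<⇒≤ (p m N N≤m ℕ.≤-refl))))

  boundedˡ : ∀ x → IsCauchy x → IsBounded₂ (λ m _ → x m)
  boundedˡ x c = let B , B>0 , N , p = cauchy⇒bounded x c in B , B>0 , N , λ m _ N≤m _ → p m N≤m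

  boundedʳ : ∀ x → IsCauchy x → IsBounded₂ (λ _ n → x n)
  boundedʳ x c = let B , B>0 , N , p = cauchy⇒bounded x c in B , B>0 , N , λ _ n _ N≤n → p n N≤n

fromℚ : ℚ → ℝ
fromℚ q .seq _  = q
fromℚ q .cauchy = null₂-resp (λ _ _ → sym (ℚ.+-inverseʳ q)) null₂-zero

infixl 6 _+ᴿ_ _-ᴿ_
infixl 7 _*ᴿ_
infix  8 -ᴿ_

_+ᴿ_ : ℝ → ℝ → ℝ
(x +ᴿ y) .seq k  = seq x k + seq y k
(x +ᴿ y) .cauchy = null₂-resp
  (λ m n → solve 4 (λ a b c d → (a :- b) :+ (c :- d) := (a :+ c) :- (b :+ d)) refl
    (seq x m) (seq x n) (seq y m) (seq y n))
  (null₂-+ (cauchy x) (cauchy y))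

-ᴿ_ : ℝ → ℝ
(-ᴿ x) .seq k  = - seq x k
(-ᴿ x) .cauchy = null₂-resp
  (λ m n → solve 2 (λ a b → :- (a :- b) := (:- a) :- (:- b)) refl (seq x m) (seq x n))
  (null₂-neg (cauchy x))

_*ᴿ_ : ℝ → ℝ → ℝ
(x *ᴿ y) .seq k  = seq x k * seq y k
(x *ᴿ y) .cauchy = null₂-resp
  (λ m n → solve 4 (λ a b c d → a :* (c :- d) :+ d :* (a :- b) := a :* c :- b :* d) refl
    (seq x m) (seq x n) (seq y m) (seq y n))
  (null₂-+ (null₂-* (boundedˡ (seq x) (cauchy x)) (cauchy y))
           (null₂-* (boundedʳ (seq y) (cauchy y)) (cauchy x)))

_-ᴿ_ : ℝ → ℝ → ℝ
x -ᴿ y = x +ᴿ (-ᴿ y)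

private abstract
  pointwise : ∀ {x y} → (∀ k → seq x k ≡ seq y k) → x ≈ᴿ y
  pointwise {x} {y} x≡y = mk≈ (null₂⇒null (null₂-resp
    (λ m _ → trans (sym (ℚ.+-inverseʳ (seq y m))) (cong (_- seq y m) (sym (x≡y m)))) null₂-zero))

  ≈ᴿ-refl : ∀ {x} → x ≈ᴿ x
  ≈ᴿ-refl = pointwise (λ _ → refl)

  ≈ᴿ-sym : ∀ {x y} → x ≈ᴿ y → y ≈ᴿ x
  ≈ᴿ-sym {x} {y} (mk≈ h) = mk≈ (null₂⇒null (null₂-resp
    (λ m _ → solve 2 (λ a b → :- (a :- b) := b :- a) refl (seq x m) (seq y m))
    (null₂-neg (null⇒null₂ h))))

  ≈ᴿ-trans : ∀ {x y z} → x ≈ᴿ y → y ≈ᴿ z → x ≈ᴿ z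
  ≈ᴿ-trans {x} {y} {z} (mk≈ h) (mk≈ k) = mk≈ (null₂⇒null (null₂-resp
    (λ m _ → solve 3 (λ a b c → (a :- b) :+ (b :- c) := a :- c) refl (seq x m) (seq y m) (seq z m))
    (null₂-+ (null⇒null₂ h) (null⇒null₂ k))))

  +ᴿ-cong : ∀ {x x′ y y′} → x ≈ᴿ x′ → y ≈ᴿ y′ → x +ᴿ y ≈ᴿ x′ +ᴿ y′
  +ᴿ-cong {x} {x′} {y} {y′} (mk≈ h) (mk≈ k) = mk≈ (null₂⇒null (null₂-resp
    (λ m _ → solve 4 (λ a b c d → (a :- b) :+ (c :- d) := (a :+ c) :- (b :+ d)) refl
      (seq x m) (seq x′ m) (seq y m) (seq y′ m))
    (null₂-+ (null⇒null₂ h) (null⇒null₂ k))))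

  -ᴿ-cong : ∀ {x y} → x ≈ᴿ y → -ᴿ x ≈ᴿ -ᴿ y
  -ᴿ-cong {x} {y} (mk≈ h) = mk≈ (null₂⇒null (null₂-resp
    (λ m _ → solve 2 (λ a b → :- (a :- b) := (:- a) :- (:- b)) refl (seq x m) (seq y m))
    (null₂-neg (null⇒null₂ h))))

  *ᴿ-cong : ∀ {x x′ y y′} → x ≈ᴿ x′ → y ≈ᴿ y′ → x *ᴿ y ≈ᴿ x′ *ᴿ y′
  *ᴿ-cong {x} {x′} {y} {y′} (mk≈ h) (mk≈ k) = mk≈ (null₂⇒null (null₂-resp
    (λ m _ → solve 4 (λ a b c d → a :* (c :- d) :+ d :* (a :- b) := a :* c :- b :* d) refl
      (seq x m) (seq x′ m) (seq y m) (seq y′ m))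
    (null₂-+ (null₂-* (boundedˡ (seq x) (cauchy x)) (null⇒null₂ k))
             (null₂-* (boundedˡ (seq y′) (cauchy y′)) (null⇒null₂ h)))))

record ℂ : Set where
  no-eta-equality
  field
    re im : ℝ

open ℂ

infix 4 _≈ᶜ_

record _≈ᶜ_ (z w : ℂ) : Set where
  constructor mk≈
  field
    re-≈ : re z ≈ᴿ re w
    im-≈ : im z ≈ᴿ im w

infixl 6 _+ᶜ_
infixl 7 _*ᶜ_
infix  8 -ᶜ_

0ᶜ 1ᶜ : ℂ
0ᶜ .re = fromℚ 0ℚ
0ᶜ .im = fromℚ 0ℚ
1ᶜ .re = fromℚ 1ℚ
1ᶜ .im = fromℚ 0ℚ

_+ᶜ_ _*ᶜ_ : ℂ → ℂ → ℂ
(z +ᶜ w) .re = re z +ᴿ re w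
(z +ᶜ w) .im = im z +ᴿ im w
(z *ᶜ w) .re = re z *ᴿ re w -ᴿ im z *ᴿ im w
(z *ᶜ w) .im = re z *ᴿ im w +ᴿ im z *ᴿ re w

-ᶜ_ : ℂ → ℂ
(-ᶜ z) .re = -ᴿ re z
(-ᶜ z) .im = -ᴿ im z

private abstract
  pointwiseᶜ : ∀ {z w} → (∀ k → seq (re z) k ≡ seq (re w) k) → (∀ k → seq (im z) k ≡ seq (im w) k) → z ≈ᶜ w
  pointwiseᶜ p q = mk≈ (pointwise p) (pointwise q)

  ≈ᶜ-refl : ∀ {z} → z ≈ᶜ z
  ≈ᶜ-refl = mk≈ ≈ᴿ-refl ≈ᴿ-refl

  ≈ᶜ-sym : ∀ {z w} → z ≈ᶜ w → w ≈ᶜ z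
  ≈ᶜ-sym (mk≈ p q) = mk≈ (≈ᴿ-sym p) (≈ᴿ-sym q)

  ≈ᶜ-trans : ∀ {z w v} → z ≈ᶜ w → w ≈ᶜ v → z ≈ᶜ v
  ≈ᶜ-trans (mk≈ p q) (mk≈ r s) = mk≈ (≈ᴿ-trans p r) (≈ᴿ-trans q s)

  +ᶜ-cong : ∀ {z z′ w w′} → z ≈ᶜ z′ → w ≈ᶜ w′ → z +ᶜ w ≈ᶜ z′ +ᶜ w′
  +ᶜ-cong (mk≈ p q) (mk≈ r s) = mk≈ (+ᴿ-cong p r) (+ᴿ-cong q s)

  -ᶜ-cong : ∀ {z w} → z ≈ᶜ w → -ᶜ z ≈ᶜ -ᶜ w
  -ᶜ-cong (mk≈ p q) = mk≈ (-ᴿ-cong p) (-ᴿ-cong q)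

  *ᶜ-cong : ∀ {z z′ w w′} → z ≈ᶜ z′ → w ≈ᶜ w′ → z *ᶜ w ≈ᶜ z′ *ᶜ w′
  *ᶜ-cong (mk≈ p q) (mk≈ r s) = mk≈
    (+ᴿ-cong (*ᴿ-cong p r) (-ᴿ-cong (*ᴿ-cong q s)))
    (+ᴿ-cong (*ᴿ-cong p s) (*ᴿ-cong q r))

  +ᶜ-assoc : ∀ z w v → (z +ᶜ w) +ᶜ v ≈ᶜ z +ᶜ (w +ᶜ v)
  +ᶜ-assoc z w v = pointwiseᶜ
    (λ k → ℚ.+-assoc (seq (re z) k) (seq (re w) k) (seq (re v) k))
    (λ k → ℚ.+-assoc (seq (im z) k) (seq (im w) k) (seq (im v) k))

  +ᶜ-comm : ∀ z w → z +ᶜ w ≈ᶜ w +ᶜ z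
  +ᶜ-comm z w = pointwiseᶜ
    (λ k → ℚ.+-comm (seq (re z) k) (seq (re w) k)) (λ k → ℚ.+-comm (seq (im z) k) (seq (im w) k))

  +ᶜ-identityˡ : ∀ z → 0ᶜ +ᶜ z ≈ᶜ z
  +ᶜ-identityˡ z = pointwiseᶜ (λ k → ℚ.+-identityˡ (seq (re z) k)) (λ k → ℚ.+-identityˡ (seq (im z) k))

  +ᶜ-identityʳ : ∀ z → z +ᶜ 0ᶜ ≈ᶜ z
  +ᶜ-identityʳ z = pointwiseᶜ (λ k → ℚ.+-identityʳ (seq (re z) k)) (λ k → ℚ.+-identityʳ (seq (im z) k))

  +ᶜ-inverseˡ : ∀ z → (-ᶜ z) +ᶜ z ≈ᶜ 0ᶜ
  +ᶜ-inverseˡ z = pointwiseᶜ (λ k → ℚ.+-inverseˡ (seq (re z) k)) (λ k → ℚ.+-inverseˡ (seq (im z) k))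

  +ᶜ-inverseʳ : ∀ z → z +ᶜ (-ᶜ z) ≈ᶜ 0ᶜ
  +ᶜ-inverseʳ z = pointwiseᶜ (λ k → ℚ.+-inverseʳ (seq (re z) k)) (λ k → ℚ.+-inverseʳ (seq (im z) k))

  *ᶜ-comm : ∀ z w → z *ᶜ w ≈ᶜ w *ᶜ z
  *ᶜ-comm z w = pointwiseᶜ
    (λ k → solve 4 (λ a b c d → a :* c :- b :* d := c :* a :- d :* b) refl (seq (re z) k) (seq (im z) k) (seq (re w) k) (seq (im w) k))
    (λ k → solve 4 (λ a b c d → a :* d :+ b :* c := c :* b :+ d :* a) refl (seq (re z) k) (seq (im z) k) (seq (re w) k) (seq (im w) k))

  *ᶜ-assoc : ∀ z w v → (z *ᶜ w) *ᶜ v ≈ᶜ z *ᶜ (w *ᶜ v)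
  *ᶜ-assoc z w v = pointwiseᶜ
    (λ k → solve 6 (λ a b c d e f →
      (a :* c :- b :* d) :* e :- (a :* d :+ b :* c) :* f := a :* (c :* e :- d :* f) :- b :* (c :* f :+ d :* e))
      refl (seq (re z) k) (seq (im z) k) (seq (re w) k) (seq (im w) k) (seq (re v) k) (seq (im v) k))
    (λ k → solve 6 (λ a b c d e f →
      (a :* c :- b :* d) :* f :+ (a :* d :+ b :* c) :* e := a :* (c :* f :+ d :* e) :+ b :* (c :* e :- d :* f))
      refl (seq (re z) k) (seq (im z) k) (seq (re w) k) (seq (im w) k) (seq (re v) k) (seq (im v) k))

  *ᶜ-identityˡ : ∀ z → 1ᶜ *ᶜ z ≈ᶜ z
  *ᶜ-identityˡ z = pointwiseᶜ
    (λ k → solve 2 (λ a b → con 1ℚ :* a :- con 0ℚ :* b := a) refl (seq (re z) k) (seq (im z) k))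
    (λ k → solve 2 (λ a b → con 1ℚ :* b :+ con 0ℚ :* a := b) refl (seq (re z) k) (seq (im z) k))

  *ᶜ-identityʳ : ∀ z → z *ᶜ 1ᶜ ≈ᶜ z
  *ᶜ-identityʳ z = pointwiseᶜ
    (λ k → solve 2 (λ a b → a :* con 1ℚ :- b :* con 0ℚ := a) refl (seq (re z) k) (seq (im z) k))
    (λ k → solve 2 (λ a b → a :* con 0ℚ :+ b :* con 1ℚ := b) refl (seq (re z) k) (seq (im z) k))

  *ᶜ-distribˡ-+ᶜ : ∀ z w v → z *ᶜ (w +ᶜ v) ≈ᶜ z *ᶜ w +ᶜ z *ᶜ v
  *ᶜ-distribˡ-+ᶜ z w v = pointwiseᶜ
    (λ k → solve 6 (λ a b c d e f →
      a :* (c :+ e) :- b :* (d :+ f) := (a :* c :- b :* d) :+ (a :* e :- b :* f))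
      refl (seq (re z) k) (seq (im z) k) (seq (re w) k) (seq (im w) k) (seq (re v) k) (seq (im v) k))
    (λ k → solve 6 (λ a b c d e f →
      a :* (d :+ f) :+ b :* (c :+ e) := (a :* d :+ b :* c) :+ (a :* f :+ b :* e))
      refl (seq (re z) k) (seq (im z) k) (seq (re w) k) (seq (im w) k) (seq (re v) k) (seq (im v) k))

  *ᶜ-distribʳ-+ᶜ : ∀ z w v → (w +ᶜ v) *ᶜ z ≈ᶜ w *ᶜ z +ᶜ v *ᶜ z
  *ᶜ-distribʳ-+ᶜ z w v = pointwiseᶜ
    (λ k → solve 6 (λ a b c d e f →
      (c :+ e) :* a :- (d :+ f) :* b := (c :* a :- d :* b) :+ (e :* a :- f :* b))
      refl (seq (re z) k) (seq (im z) k) (seq (re w) k) (seq (im w) k) (seq (re v) k) (seq (im v) k))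
    (λ k → solve 6 (λ a b c d e f →
      (c :+ e) :* b :+ (d :+ f) :* a := (c :* b :+ d :* a) :+ (e :* b :+ f :* a))
      refl (seq (re z) k) (seq (im z) k) (seq (re w) k) (seq (im w) k) (seq (re v) k) (seq (im v) k))

ℂ-commutativeRing : CommutativeRing 0ℓ 0ℓ
ℂ-commutativeRing = record
  { Carrier = ℂ ; _≈_ = _≈ᶜ_ ; _+_ = _+ᶜ_ ; _*_ = _*ᶜ_ ; -_ = -ᶜ_ ; 0# = 0ᶜ ; 1# = 1ᶜ
  ; isCommutativeRing = record
    { isRing = record
      { +-isAbelianGroup = record
        { isGroup = record
          { isMonoid = record
            { isSemigroup = record
              { isMagma = record
                { isEquivalence = record { refl = ≈ᶜ-refl ; sym = ≈ᶜ-sym ; trans = ≈ᶜ-trans }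
                ; ∙-cong = +ᶜ-cong
                }
              ; assoc = +ᶜ-assoc
              }
            ; identity = +ᶜ-identityˡ , +ᶜ-identityʳ
            }
          ; inverse = +ᶜ-inverseˡ , +ᶜ-inverseʳ
          ; ⁻¹-cong = -ᶜ-cong
          }
        ; comm = +ᶜ-comm
        }
      ; *-cong = *ᶜ-cong
      ; *-assoc = *ᶜ-assoc
      ; *-identity = *ᶜ-identityˡ , *ᶜ-identityʳ
      ; distrib = *ᶜ-distribˡ-+ᶜ , *ᶜ-distribʳ-+ᶜ
      }
    ; *-comm = *ᶜ-comm
    }
  }

private
  module C = CommutativeRing ℂ-commutativeRing

open Exp C.semiring public using () renaming (_^_ to _^ᶜ_)

infixl 6 _-ᶜ_

_-ᶜ_ : ℂ → ℂ → ℂ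
_-ᶜ_ = C._-_

IsRoot : (ℂ → ℂ) → ℂ → Set
IsRoot p α = p α ≈ᶜ 0ᶜ

f : (s n : ℕ) → ℂ → ℂ
f s n x = (x ^ᶜ s -ᶜ 1ᶜ) ^ᶜ n -ᶜ x ^ᶜ (n ∸ 1) *ᶜ (x ^ᶜ (s ∸ 1) -ᶜ 1ᶜ) ^ᶜ n

g : (s n : ℕ) → ℂ → ℂ
g s n x = x ^ᶜ (n ℕ.* s) -ᶜ x ^ᶜ (n ℕ.* s ∸ 1) +ᶜ x ^ᶜ (n ∸ 1) -ᶜ 1ᶜ

{-# OPTIONS --safe #-}
-- Put β = α ^ n.  Since n s − 1 = (n − 1) + n (s − 1), the equation g(α) = 0 reads
-- β ^ s − 1 = α ^ (n − 1) (β ^ (s − 1) − 1), and its n-th power is f(β) = 0.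
module Submission where

open import Defs using (ℂ; _^ᶜ_; IsRoot; f; g; ℂ-commutativeRing)
open import Data.Nat.Base using (ℕ; _≤_; suc)
open import Algebra.Bundles using (CommutativeRing)
import Algebra.Properties.CommutativeSemiring.Exp as Exp
import Algebra.Properties.Ring as RingProperties
import Data.Nat.Base as ℕ
import Data.Nat.Properties as ℕ
import Relation.Binary.PropositionalEquality as ≡
import Relation.Binary.Reasoning.Setoid as SetoidReasoning

-- The argument is pure commutative-ring algebra. Pairing the terms of g so that the leading power
-- meets the constant leaves one factor α ^ (n - 1) outside powers of β (`g-root⇒factorisation`).
-- Taking n-th powers turns that factor into β ^ (n - 1), which is where f gets its shape
-- (`g-root⇒f-root`).

module _ {c ℓ} (R : CommutativeRing c ℓ) where
  open CommutativeRing R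
  open Exp commutativeSemiring
  open RingProperties ring
  open SetoidReasoning setoid

  -- Regroups the four terms of g, in their order, so that its vanishing becomes an equation between
  -- two differences.
  -‿interchange : ∀ a b c d → (a - d) - (b - c) ≈ a - b + c - d
  -‿interchange a b c d = begin
    (a - d) - (b - c)        ≈⟨ +-congˡ (⁻¹-anti-homo‿- b c) ⟩
    (a - d) + (c - b)        ≈⟨ +-congʳ (+-comm a (- d)) ⟩
    (- d + a) + (c - b)      ≈⟨ +-assoc (- d) a (c - b) ⟩
    - d + (a + (c - b))      ≈⟨ +-comm (- d) _ ⟩
    a + (c - b) - d          ≈⟨ +-congʳ (+-congˡ (+-comm c (- b))) ⟩
    a + (- b + c) - d        ≈⟨ +-congʳ (+-assoc a (- b) c) ⟨
    a - b + c - d            ∎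

  ^-comm : ∀ x m n → (x ^ m) ^ n ≈ (x ^ n) ^ m
  ^-comm x m n = begin
    (x ^ m) ^ n    ≈⟨ ^-assocʳ x m n ⟩
    x ^ (m ℕ.* n)  ≡⟨ ≡.cong (x ^_) (ℕ.*-comm m n) ⟩
    x ^ (n ℕ.* m)  ≈⟨ ^-assocʳ x n m ⟨
    (x ^ n) ^ m    ∎

  module _ (m t : ℕ) (α : Carrier) where
    private
      n s : ℕ
      n = suc m
      s = suc t
      β : Carrier
      β = α ^ n

    g-root⇒factorisation : α ^ (n ℕ.* s) - α ^ (n ℕ.* s ℕ.∸ 1) + α ^ m - 1# ≈ 0# →
                           β ^ s - 1# ≈ α ^ m * (β ^ t - 1#)
    g-root⇒factorisation gα≈0 = begin
      β ^ s - 1#                       ≈⟨ +-congʳ (^-assocʳ α n s) ⟩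
      α ^ (n ℕ.* s) - 1#               ≈⟨ x∙y⁻¹≈ε⇒x≈y _ _ (trans (-‿interchange _ _ _ _) gα≈0) ⟩
      -- Since `n` is `suc m`, the exponent `n + n * t ∸ 1` computes to `m + n * t`.
      α ^ (n ℕ.* s ℕ.∸ 1) - α ^ m      ≡⟨ ≡.cong (λ k → α ^ (k ℕ.∸ 1) - α ^ m) (ℕ.*-suc n t) ⟩
      α ^ (m ℕ.+ n ℕ.* t) - α ^ m      ≈⟨ +-congʳ (^-homo-* α m (n ℕ.* t)) ⟩
      α ^ m * α ^ (n ℕ.* t) - α ^ m    ≈⟨ +-cong (*-congˡ (^-assocʳ α n t)) (-‿cong (*-identityʳ (α ^ m))) ⟨
      α ^ m * β ^ t - α ^ m * 1#       ≈⟨ x[y-z]≈xy-xz (α ^ m) (β ^ t) 1# ⟨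
      α ^ m * (β ^ t - 1#)             ∎

    g-root⇒f-root : α ^ (n ℕ.* s) - α ^ (n ℕ.* s ℕ.∸ 1) + α ^ m - 1# ≈ 0# →
                    (β ^ s - 1#) ^ n - β ^ m * (β ^ t - 1#) ^ n ≈ 0#
    g-root⇒f-root gα≈0 = x≈y⇒x∙y⁻¹≈ε (begin
      (β ^ s - 1#) ^ n               ≈⟨ ^-congˡ n (g-root⇒factorisation gα≈0) ⟩
      (α ^ m * (β ^ t - 1#)) ^ n     ≈⟨ ^-distrib-* (α ^ m) (β ^ t - 1#) n ⟩
      (α ^ m) ^ n * (β ^ t - 1#) ^ n ≈⟨ *-congʳ (^-comm α m n) ⟩
      β ^ m * (β ^ t - 1#) ^ n       ∎)

theorem6 : (s n : ℕ) → 2 ≤ s → 2 ≤ n → (α : ℂ) → IsRoot (g s n) α → IsRoot (f s n) (α ^ᶜ n)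
-- Matching on `suc` lets the truncated `s ∸ 1` and `n ∸ 1` compute to `t` and `m`, so both root
-- conditions unfold to the ring equations.
theorem6 (suc t) (suc m) _ _ = g-root⇒f-root ℂ-commutativeRing m t
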